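{- Let $\mathcal{A},\mathcal{B}\subseteq\mathcal{P}_\infty(\mathbb{N})$ be hereditary orthogonal families. Assume $\mathcal{A}$ is analytic and not countably generated in $\mathcal{B}^\perp$. Then there is a one-to-one map $\phi:\Sigma\to\mathbb{N}$ such that, with $\mathcal{E}=\{\phi^{ -1}(A):A\in\mathcal{A}\}$ and $\mathcal{H}=\{\phi^{ -1}(B):B\in\mathcal{B}\}$: (i) for every $\sigma\in[\Sigma]$, the set $\{\sigma|n:n\in\mathbb{N}\}$ belongs to $\mathcal{E}$; (ii) for every $t\in\Sigma$, the set $\{t\cup\{n\}:n\in\mathbb{N},\ t<\{n\}\}$ belongs to $\mathcal{H}$.
   Context: $\Sigma$ is the tree of all strictly increasing finite sequences of natural numbers (ordered by end-extension), each element also viewed as a finite subset of $\mathbb{N}$; for $s,t\in\Sigma$ nonempty, $s<t$ means $\max s<\min t$, and $\varnothing<t$ for all nonempty $t$; $t\cup\{n\}$ with $t<\{n\}$ is the one-point extension. $[\Sigma]$ is the set of infinite strictly increasing sequences $\sigma$, and $\sigma|n$ is its initial segment of length $n$. $\mathcal{P}_\infty(X)$: infinite subsets of $X$ (topology of $2^X$). Hereditary: closed under infinite subsets. Orthogonal: $A\cap B$ finite for all $A\in\mathcal{A}$, $B\in\mathcal{B}$; $\mathcal{B}^\perp$ is the set of infinite sets almost disjoint from every member of $\mathcal{B}$. $\mathcal{A}$ is countably generated in $\mathcal{D}$ if there are $D_n\in\mathcal{D}$ such that each $A\in\mathcal{A}$ has $A\setminus D_n$ finite for some $n$. -}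

module Defs where

open import Data.List.Base using (List; []; _∷_; _∷ʳ_; applyUpTo)
open import Data.List.Membership.Propositional using () renaming (_∈_ to _∈ₗ_)
open import Data.List.Relation.Unary.All as All using (All; []; _∷_)
open import Data.List.Relation.Unary.AllPairs using (AllPairs; []; _∷_)
import Data.List.Relation.Unary.AllPairs.Properties as AllPairs
open import Data.Nat.Base using (ℕ; _<_)
open import Data.Product.Base using (_×_; Σ-syntax; ∃-syntax)
open import Data.Sum.Base using (_⊎_)
open import Function.Bundles using (_⇔_)
open import Level using (0ℓ)
import Level
open import Relation.Binary.Core using (_Preserves_⟶_)
open import Relation.Binary.PropositionalEquality.Core using (_≡_)
open import Relation.Nullary.Negation.Core using (¬_)
open import Relation.Unary using (Pred; _∈_; _⊆_; _≐_; _∩_; _∖_; _⊢_; Empty)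

1ℓ : Level.Level
1ℓ = Level.suc 0ℓ

Subset : Set → Set₁
Subset X = Pred X 0ℓ

-- Families are arbitrary predicates on subsets.  Those satisfying
-- `Hereditary` and consisting of infinite sets automatically respect
-- extensional equality _≐_.
Family : Set → Set₂
Family X = Pred (Subset X) 1ℓ

Finite : {X : Set} → Subset X → Set
Finite {X} A = Σ[ xs ∈ List X ] (A ⊆ (_∈ₗ xs))

Infinite : {X : Set} → Subset X → Set
Infinite A = ¬ Finite A

Hereditary : {X : Set} → Family X → Set₁
Hereditary {X} 𝒜 = ∀ {A A′ : Subset X} → A ∈ 𝒜 → A′ ⊆ A → Infinite A′ → A′ ∈ 𝒜

Orthogonal : {X : Set} → Family X → Family X → Set₁
Orthogonal {X} 𝒜 ℬ = ∀ {A B : Subset X} → A ∈ 𝒜 → B ∈ ℬ → Finite (A ∩ B)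

infix 10 _^⊥

_^⊥ : {X : Set} → Family X → Family X
_^⊥ {X} ℬ D = Infinite D × (∀ {B : Subset X} → B ∈ ℬ → Finite (D ∩ B))

-- The generating sets are indexed by a set I of natural numbers, so that
-- "countably many" includes "none".  This matters only if both 𝒜 and 𝒟
-- are empty, in which case 𝒜 counts as countably generated in 𝒟.
CountablyGeneratedIn : {X : Set} → Family X → Family X → Set₁
CountablyGeneratedIn {X} 𝒜 𝒟 =
  Σ[ I ∈ Subset ℕ ] Σ[ D ∈ (ℕ → Subset X) ]
    (∀ {n} → n ∈ I → D n ∈ 𝒟) ×
    (∀ {A : Subset X} → A ∈ 𝒜 → ∃[ n ] (n ∈ I × Finite (A ∖ D n)))

-- Continuity from Baire space ℕ^ℕ to the power set of ℕ, the latter with the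
-- topology of 2^ℕ: membership of each j < m in f x depends, near x, only on
-- a finite initial segment of x.
Continuous : ((ℕ → ℕ) → Subset ℕ) → Set
Continuous f =
  ∀ x m → ∃[ k ] (∀ y → (∀ {i} → i < k → x i ≡ y i) →
                        ∀ {j} → j < m → (j ∈ f x ⇔ j ∈ f y))

-- Empty, or a continuous image of Baire space.
Analytic : Family ℕ → Set₁
Analytic 𝒜 =
  Empty 𝒜 ⊎
  (Σ[ f ∈ ((ℕ → ℕ) → Subset ℕ) ] (Continuous f × (𝒜 ≐ (λ A → ∃[ x ] (A ≐ f x)))))

infix 10 _⁻¹[_]

_⁻¹[_] : {X Y : Set} → (X → Y) → Family Y → Family X
_⁻¹[_] {X} {Y} φ 𝒜 E = Σ[ A ∈ Subset Y ] (A ∈ 𝒜 × (E ≐ (φ ⊢ A)))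

-- The tree Σ.  The proof field is irrelevant so that _≡_ on FinSeq is
-- equality of the underlying lists.
record FinSeq : Set where
  constructor mkFinSeq
  field
    seq         : List ℕ
    .increasing : AllPairs _<_ seq

open FinSeq public using (seq)

-- [Σ]
record InfSeq : Set where
  constructor mkInfSeq
  field
    at         : ℕ → ℕ
    increasing : at Preserves _<_ ⟶ _<_

open InfSeq public using (at)

infix 4 _<[_]

-- t < {n}, that is max t < n; vacuous for the empty sequence.
_<[_] : FinSeq → ℕ → Set
t <[ n ] = All (_< n) (seq t)

-- t ∪ {n}
extend : (t : FinSeq) (n : ℕ) → t <[ n ] → FinSeq
extend (mkFinSeq s inc) n s<n =
  mkFinSeq (s ∷ʳ n)
    (AllPairs.++⁺ inc ([] ∷ []) (All.map (λ x<n → x<n ∷ []) s<n))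

-- σ|n
_∣_ : InfSeq → ℕ → FinSeq
σ ∣ n =
  mkFinSeq (applyUpTo (at σ) n)
    (AllPairs.applyUpTo⁺₁ (at σ) n (λ i<j _ → InfSeq.increasing σ i<j))

branch : InfSeq → Subset FinSeq
branch σ u = ∃[ n ] (u ≡ σ ∣ n)

successors : FinSeq → Subset FinSeq
successors t u = ∃[ n ] Σ[ t<n ∈ t <[ n ] ] (u ≡ extend t n t<n)

{-# OPTIONS --safe #-}

-- Let f map Baire space continuously onto 𝒜.  Removing the countably many cones
-- whose f-image is countably generated in ℬ^⊥ leaves a closed set of points all of
-- whose cones are not.  Below any such cone, the union D of the f-images of the
-- remaining points is not in ℬ^⊥, so D meets some B ∈ ℬ in an infinite set, and each
-- n ∈ B ∩ D is forced into f by a smaller cone of the same kind.  Iterating along Σ,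
-- with values n chosen ever larger, makes the successors of every t map into a
-- member of ℬ, while the cones along a branch shrink to a point x and their values
-- lie in f x ∈ 𝒜.
module Submission where

open import Defs
open import Axiom.ExcludedMiddle using (ExcludedMiddle)
open import Data.Empty using (⊥)
open import Data.List.Base using (List; []; _∷_; _∷ʳ_; applyUpTo; upTo; reverse; length)
open import Data.List.Extrema.Nat using (max; xs≤max)
open import Data.List.Membership.Propositional.Properties using (∈-upTo⁺)
open import Data.List.Properties
  using (∷-injective; applyUpTo-∷ʳ; reverse-++; reverse-injective; length-reverse; length-applyUpTo)
open import Data.List.Relation.Unary.All as All using (All)
open import Data.Nat.Base using (ℕ; zero; suc; _+_; _≤_; _<_; _⊔_; z≤n; s≤s; s<s⁻¹)
open import Data.Nat.Induction using (<-wellFounded; <-rec; <-Rec)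
open import Data.Nat.Properties
open import Data.Product.Base using (_×_; _,_; proj₁; proj₂; Σ-syntax; ∃; ∃-syntax)
open import Data.Product.Properties using (,-injective)
open import Data.Sum.Base using (inj₁; inj₂)
open import Function.Base using (_∘_; case_of_; id)
open import Function.Bundles using (Equivalence)
open import Function.Definitions using (Injective)
open import Induction.WellFounded using (module FixPoint)
open import Level using (0ℓ; Lift; lift; lower)
open import Relation.Binary.Definitions using (tri<; tri≈; tri>)
open import Relation.Binary.PropositionalEquality.Core using (_≡_; refl; sym; trans; cong; cong₂; subst)
open import Relation.Nullary.Decidable using (Dec; yes; no; map′; True; toWitness; fromWitness; decidable-stable)
open import Relation.Nullary.Negation.Core using (¬_; contradiction)
open import Relation.Unary using (Pred; _∈_; _⊆_; _∩_; _∖_)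

-- Pairing of numbers and coding of finite sequences.

unpair : ℕ → ℕ × ℕ
unpair zero = 0 , 0
unpair (suc n) with unpair n
... | a , zero  = 0 , suc a
... | a , suc b = suc a , b

unpair-sum-≤ : ∀ n → proj₁ (unpair n) + proj₂ (unpair n) ≤ n
unpair-sum-≤ zero = z≤n
unpair-sum-≤ (suc n) with unpair n | unpair-sum-≤ n
... | a , zero  | le = s≤s (≤-trans (m≤m+n a 0) le)
... | a , suc b | le = s≤s (≤-trans (+-monoʳ-≤ a (n≤1+n b)) le)

unpair₁-≤ : ∀ n → proj₁ (unpair n) ≤ n
unpair₁-≤ n = ≤-trans (m≤m+n _ _) (unpair-sum-≤ n)

unpair₂-≤ : ∀ n → proj₂ (unpair n) ≤ n
unpair₂-≤ n = ≤-trans (m≤n+m _ _) (unpair-sum-≤ n)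

-- `unpair` runs through each antidiagonal from `(0 , s)` to `(s , 0)`: `down` moves along one,
-- `restart` jumps to the next.
unpair-surjective : ∀ a b → ∃[ n ] unpair n ≡ (a , b)
unpair-surjective a b = walk a b (start (a + b))
  where
  down : ∀ {a b} n → unpair n ≡ (a , suc b) → unpair (suc n) ≡ (suc a , b)
  down n eq rewrite eq = refl

  restart : ∀ {a} n → unpair n ≡ (a , 0) → unpair (suc n) ≡ (0 , suc a)
  restart n eq rewrite eq = refl

  walk : ∀ a b → ∃[ n ] unpair n ≡ (0 , a + b) → ∃[ n ] unpair n ≡ (a , b)
  walk zero    b p = p
  walk (suc a) b (n , eq) with walk a (suc b) (n , trans eq (cong (0 ,_) (sym (+-suc a b))))
  ... | m , eq′ = suc m , down m eq′

  start : ∀ s → ∃[ n ] unpair n ≡ (0 , s)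
  start zero    = 0 , refl
  start (suc s) with start s
  ... | n , eq with walk s 0 (n , trans eq (cong (0 ,_) (sym (+-identityʳ s))))
  ... | m , eq′ = suc m , restart m eq′

abstract
  pair : ℕ → ℕ → ℕ
  pair a b = proj₁ (unpair-surjective a b)

  unpair-pair : ∀ a b → unpair (pair a b) ≡ (a , b)
  unpair-pair a b = proj₂ (unpair-surjective a b)

pair-injective : ∀ {a b c d} → pair a b ≡ pair c d → (a , b) ≡ (c , d)
pair-injective {a} {b} {c} {d} eq =
  trans (sym (unpair-pair a b)) (trans (cong unpair eq) (unpair-pair c d))

m≤pair : ∀ m n → m ≤ pair m n
m≤pair m n = subst (_≤ pair m n) (cong proj₁ (unpair-pair m n)) (unpair₁-≤ (pair m n))

n≤pair : ∀ m n → n ≤ pair m n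
n≤pair m n = subst (_≤ pair m n) (cong proj₂ (unpair-pair m n)) (unpair₂-≤ (pair m n))

code : List ℕ → ℕ
code []      = 0
code (n ∷ s) = suc (pair (code s) n)

code-injective : Injective _≡_ _≡_ code
code-injective {[]}    {[]}    _  = refl
code-injective {m ∷ s} {n ∷ t} eq with ,-injective (pair-injective (suc-injective eq))
... | s≡t , m≡n = cong₂ _∷_ m≡n (code-injective s≡t)

length≤code : ∀ s → length s ≤ code s
length≤code []      = z≤n
length≤code (n ∷ s) = s≤s (≤-trans (length≤code s) (m≤pair (code s) n))

-- Increasing functions, infinite sets and images.

Increasing : (ℕ → ℕ) → Set
Increasing g = ∀ n → g n < g (suc n)

increasing⇒mono-≤ : ∀ {g} → Increasing g → ∀ {m n} → m ≤ n → g m ≤ g n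
increasing⇒mono-≤ inc {n = zero}  z≤n = ≤-refl
increasing⇒mono-≤ inc {n = suc n} m≤1+n with m≤n⇒m<n∨m≡n m≤1+n
... | inj₁ m<1+n = ≤-trans (increasing⇒mono-≤ inc (m<1+n⇒m≤n m<1+n)) (<⇒≤ (inc n))
... | inj₂ refl  = ≤-refl

increasing⇒mono-< : ∀ {g} → Increasing g → ∀ {m n} → m < n → g m < g n
increasing⇒mono-< inc {m} m<n = <-≤-trans (inc m) (increasing⇒mono-≤ inc m<n)

increasing⇒injective : ∀ {g} → Increasing g → Injective _≡_ _≡_ g
increasing⇒injective inc {m} {n} eq with <-cmp m n
... | tri< m<n _ _ = contradiction eq (<⇒≢ (increasing⇒mono-< inc m<n))
... | tri≈ _ m≡n _ = m≡n
... | tri> _ _ n<m = contradiction (sym eq) (<⇒≢ (increasing⇒mono-< inc n<m))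

increasing⇒n≤ : ∀ {g} → Increasing g → ∀ n → n ≤ g n
increasing⇒n≤ inc zero    = z≤n
increasing⇒n≤ inc (suc n) = ≤-<-trans (increasing⇒n≤ inc n) (inc n)

unbounded⇒infinite : {A : Subset ℕ} → (∀ m → ∃[ n ] (m ≤ n × n ∈ A)) → Infinite A
unbounded⇒infinite unbounded (xs , A⊆xs) with unbounded (suc (max 0 xs))
... | n , max<n , n∈A = <⇒≱ max<n (All.lookup (xs≤max 0 xs) (A⊆xs n∈A))

finite-⊆ : {X : Set} {A B : Subset X} → A ⊆ B → Finite B → Finite A
finite-⊆ A⊆B (xs , B⊆xs) = xs , λ x∈A → B⊆xs (A⊆B x∈A)

image : {X Y : Set} → (X → Y) → Subset X → Subset Y
image φ E y = ∃[ u ] (u ∈ E × φ u ≡ y)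

image∈⇒∈⁻¹ : {X Y : Set} {φ : X → Y} {𝒜 : Family Y} → Injective _≡_ _≡_ φ →
             ∀ {E} → image φ E ∈ 𝒜 → E ∈ φ ⁻¹[ 𝒜 ]
image∈⇒∈⁻¹ {φ = φ} inj {E} im∈𝒜 =
  image φ E , im∈𝒜 , (λ u∈E → _ , u∈E , refl) , λ (_ , v∈E , eq) → subst E (inj eq) v∈E

-- Cones in Baire space.

Cone : (ℕ → ℕ) → ℕ → Pred (ℕ → ℕ) _
Cone x k y = ∀ {i} → i < k → x i ≡ y i

applyUpTo≡⇒Cone : ∀ {x y} k l → applyUpTo y l ≡ applyUpTo x k → y ∈ Cone x k
applyUpTo≡⇒Cone (suc k) (suc l) eq {zero}  _   = sym (proj₁ (∷-injective eq))
applyUpTo≡⇒Cone (suc k) (suc l) eq {suc i} i<k =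
  applyUpTo≡⇒Cone k l (proj₂ (∷-injective eq)) (s<s⁻¹ i<k)

-- The same cones indexed by finite lists, so that `code` enumerates them.
ListCone : List ℕ → Pred (ℕ → ℕ) _
ListCone s x = ∃[ k ] applyUpTo x k ≡ s

-- When the cones shrink, the i-th coordinate is settled from stage i + 1 on.
limit : (ℕ → ℕ → ℕ) → ℕ → ℕ
limit x i = x (suc i) i

-- Stages `n` and `suc i` agree at `i`, since the earlier of the two already fixes that coordinate:
-- the former by `i < k n`, the latter by `suc i ≤ k (suc i)`.
limit∈Cone : ∀ {x k} → Increasing k →
             (∀ n → x (suc n) ∈ Cone (x n) (k n)) → ∀ n → limit x ∈ Cone (x n) (k n)
limit∈Cone {x} {k} inc shrink n {i} i<k = case ≤-total n (suc i) of λ where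
    (inj₁ n≤1+i) → nested n≤1+i i<k
    (inj₂ 1+i≤n) → sym (nested 1+i≤n (increasing⇒n≤ inc (suc i)))
  where
  nested : ∀ {m n} → m ≤ n → x n ∈ Cone (x m) (k m)
  nested {n = zero}  z≤n   _   = refl
  nested {n = suc n} m≤1+n i<k with m≤n⇒m<n∨m≡n m≤1+n
  ... | inj₂ refl  = refl
  ... | inj₁ m<1+n = trans (nested m≤n i<k) (shrink n (<-≤-trans i<k (increasing⇒mono-≤ inc m≤n)))
    where m≤n = m<1+n⇒m≤n m<1+n

-- Excluded middle and countable generation.

module Classical (em : ExcludedMiddle 1ℓ) where

  em₀ : {P : Set} → Dec P
  em₀ = map′ lower lift (em {Lift 1ℓ _})

  infinite⇒unbounded : {A : Subset ℕ} → Infinite A → ∀ m → ∃[ n ] (m ≤ n × n ∈ A)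
  infinite⇒unbounded {A} inf m = decidable-stable em₀ λ bounded →
    inf (upTo m , λ {n} n∈A → ∈-upTo⁺ (≰⇒> λ m≤n → bounded (n , m≤n , n∈A)))

module Generation (em : ExcludedMiddle 1ℓ) (ℬ : Family ℕ) (f : (ℕ → ℕ) → Subset ℕ) where

  open Classical em

  -- `CountablyGeneratedIn` for the family f[P] in `ℬ ^⊥`, phrased through points so that `P` may
  -- live at any level.
  Generated : ∀ {ℓ} → Pred (ℕ → ℕ) ℓ → Set (1ℓ Level.⊔ ℓ)
  Generated P =
    Σ[ I ∈ Subset ℕ ] Σ[ D ∈ (ℕ → Subset ℕ) ]
      (∀ {n} → n ∈ I → D n ∈ ℬ ^⊥) ×
      (∀ {x} → x ∈ P → ∃[ n ] (n ∈ I × Finite (f x ∖ D n)))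

  generated-⊆ : ∀ {ℓ ℓ′} {P : Pred (ℕ → ℕ) ℓ} {Q : Pred (ℕ → ℕ) ℓ′} →
                P ⊆ Q → Generated Q → Generated P
  generated-⊆ P⊆Q (I , D , D∈ , covers) = I , D , D∈ , covers ∘ P⊆Q

  generated-empty : ∀ {ℓ} {P : Pred (ℕ → ℕ) ℓ} → (∀ {x} → ¬ P x) → Generated P
  generated-empty ¬P = (λ _ → ⊥) , (λ _ _ → ⊥) , (λ ()) , λ x∈P → contradiction x∈P ¬P

  generated-⋃ : ∀ {ℓ} {P : ℕ → Pred (ℕ → ℕ) ℓ} →
                (∀ k → Generated (P k)) → Generated (λ x → ∃[ k ] P k x)
  generated-⋃ gen =
    (λ n → I (unpair n)) , (λ n → D (unpair n)) , (λ {n} → D∈ (unpair n)) ,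
    λ (k , x∈P) → let m , m∈I , fin = proj₂ (proj₂ (proj₂ (gen k))) x∈P
                  in pair k m ,
                     subst I (sym (unpair-pair k m)) m∈I ,
                     subst (λ km → Finite (f _ ∖ D km)) (sym (unpair-pair k m)) fin
    where
    I : ℕ × ℕ → Set
    I (k , m) = proj₁ (gen k) m
    D : ℕ × ℕ → Subset ℕ
    D (k , m) = proj₁ (proj₂ (gen k)) m
    D∈ : ∀ km → I km → D km ∈ ℬ ^⊥
    D∈ (k , m) = proj₁ (proj₂ (proj₂ (gen k)))

  -- The kernel left after deleting all generated cones, in analogy with Cantor-Bendixson.
  Perfect : Pred (ℕ → ℕ) 1ℓ
  Perfect x = ¬ (∃[ k ] Generated (Cone x k))

  -- Only countably many cones can be generated, so their union is negligible.
  generated-∩-perfect : ∀ {P : Pred (ℕ → ℕ) 0ℓ} → Generated (P ∩ Perfect) → Generated P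
  generated-∩-perfect {P} gen = generated-⊆ cover (generated-⋃ pieces)
    where
    piece : ℕ → Pred (ℕ → ℕ) 1ℓ
    piece zero    = P ∩ Perfect
    -- A number `c` that codes no generated cone contributes an empty piece.
    piece (suc c) x = ∃[ s ] (code s ≡ c × Generated (ListCone s) × x ∈ ListCone s)
    pieces : ∀ k → Generated (piece k)
    pieces zero = gen
    pieces (suc c) with em {∃[ s ] (code s ≡ c × Generated (ListCone s))}
    ... | no ¬s = generated-empty λ (s , eq , gen-s , _) → ¬s (s , eq , gen-s)
    ... | yes (s , eq , gen-s) = generated-⊆ (λ (t , eq′ , _ , x∈t) →
        subst (λ s → _ ∈ ListCone s) (code-injective (trans eq′ (sym eq))) x∈t) gen-s
    cover : P ⊆ (λ x → ∃[ k ] piece k x)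
    cover {x} x∈P with em {∃[ k ] Generated (Cone x k)}
    ... | no perfect = 0 , x∈P , perfect
    ... | yes (k , gen-k) =
      suc (code s) , s , refl , generated-⊆ (λ (l , eq) → applyUpTo≡⇒Cone k l eq) gen-k , k , refl
      where s = applyUpTo x k

-- The splitting step.

module Construction
  (em : ExcludedMiddle 1ℓ) (ℬ : Family ℕ) (f : (ℕ → ℕ) → Subset ℕ)
  (f-infinite : ∀ x → Infinite (f x)) (f-continuous : Continuous f) where

  open Classical em
  open Generation em ℬ f

  -- If ⋃ f[Q] is almost disjoint from all of ℬ, it generates f[Q] by itself.
  ¬generated⇒large : ∀ {Q : Pred (ℕ → ℕ) 1ℓ} → ¬ Generated Q →
    Σ[ B ∈ Subset ℕ ] (B ∈ ℬ ×
      (∀ m → ∃[ n ] (m ≤ n × n ∈ B × (∃[ x ] (x ∈ Q × n ∈ f x)))))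
  ¬generated⇒large {Q} ¬gen = case em {Σ[ B ∈ Subset ℕ ] (B ∈ ℬ × Infinite (D ∩ B))} of λ where
      (yes (B , B∈ℬ , inf)) → B , B∈ℬ , λ m →
        let n , m≤n , n∈D , n∈B = infinite⇒unbounded inf m
        in n , m≤n , n∈B , toWitness n∈D
      (no ¬B) → contradiction
        (D-generates λ B∈ℬ → decidable-stable em₀ λ inf → ¬B (_ , B∈ℬ , inf)) ¬gen
    where
    -- ⋃ f[Q], resized to the lowest universe by excluded middle.
    D : Subset ℕ
    D n = True (em {∃[ x ] (x ∈ Q × n ∈ f x)})

    f⊆D : ∀ {x} → x ∈ Q → f x ⊆ D
    f⊆D x∈Q n∈fx = fromWitness (_ , x∈Q , n∈fx)

    D-generates : (∀ {B} → B ∈ ℬ → Finite (D ∩ B)) → Generated Q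
    D-generates D⊥ =
      -- Members of `ℬ ^⊥` are infinite, and `D` is so once `Q` has a point; for empty `Q` no
      -- generator is offered.
      (λ _ → True (em {∃ Q})) , (λ _ → D) ,
      (λ ne → D-infinite (toWitness {a? = em {∃ Q}} ne) , D⊥) ,
      λ x∈Q → 0 , fromWitness (_ , x∈Q) ,
        [] , λ (n∈fx , n∉D) → contradiction (f⊆D x∈Q n∈fx) n∉D
      where
      D-infinite : ∃ Q → Infinite D
      D-infinite (x , x∈Q) D-fin = f-infinite x (finite-⊆ (f⊆D x∈Q) D-fin)

  record Position : Set₁ where
    field
      point : ℕ → ℕ
      depth : ℕ
      large : ¬ Generated (Cone point depth)

    cone : Pred (ℕ → ℕ) _
    cone = Cone point depth

  open Position

  record Node : Set₁ where
    field
      position : Position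
      value    : ℕ
      value∈   : ∀ {y} → y ∈ cone position → value ∈ f y

    open Position position public

  open Node using (position; value; value∈)

  record Step (p : Position) (B : Subset ℕ) (q : Node) : Set where
    field
      deeper  : depth p < Node.depth q
      refine  : Node.point q ∈ cone p
      value∈B : value q ∈ B

  step : ∀ p → Σ[ B ∈ Subset ℕ ] (B ∈ ℬ × (∀ m → ∃[ q ] (m < value q × Step p B q)))
  -- Only perfect points of the cone are offered as witnesses, so every cone around one is again a
  -- legitimate position.
  step p with ¬generated⇒large (large p ∘ generated-∩-perfect)
  ... | B , B∈ℬ , pick = B , B∈ℬ , make
    where
    make : ∀ m → ∃[ q ] (m < value q × Step p B q)
    make m with pick (suc m)
    -- The modulus settles membership only below its bound, so `suc n` is needed to settle `n`
    -- itself.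
    ... | n , m<n , n∈B , x , (x∈p , perfect) , n∈fx with f-continuous x (suc n)
    ... | k , modulus = q , m<n , record
      { deeper  = m≤m⊔n (suc (depth p)) k
      ; refine  = x∈p
      ; value∈B = n∈B
      }
      where
      q : Node
      q = record
        { position = record
          { point = x
          -- The first term makes depths grow strictly, so cones along a branch shrink to a point;
          -- `k` forces `n` into `f y`.
          ; depth = suc (depth p) ⊔ k
          ; large = λ gen → perfect (_ , gen)
          }
        ; value  = n
        ; value∈ = λ {y} y∈ → Equivalence.to
            (modulus y (λ i<k → y∈ (<-≤-trans i<k (m≤n⊔m (suc (depth p)) k))) ≤-refl) n∈fx
        }

  -- The tree of nodes and the map `φ`.

  module Tree (root : Position) where

    child : Position → ℕ → Node
    child p m = proj₁ (proj₂ (proj₂ (step p)) m)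

    child-value : ∀ p m → m < value (child p m)
    child-value p m = proj₁ (proj₂ (proj₂ (proj₂ (step p)) m))

    splitting : Position → Subset ℕ
    splitting p = proj₁ (step p)

    splitting∈ℬ : ∀ p → splitting p ∈ ℬ
    splitting∈ℬ p = proj₁ (proj₂ (step p))

    child-step : ∀ p m → Step p (splitting p) (child p m)
    child-step p m = proj₂ (proj₂ (proj₂ (proj₂ (step p)) m))

    build : ∀ n → <-Rec (λ _ → Node) n → Node
    -- The empty sequence needs a value too, so its node is a child of `root`; the bound 0 is
    -- arbitrary.
    build zero    rec = child root 0
    build (suc n) rec =
      child (position (rec (s≤s (unpair₁-≤ n)))) (value (rec (n<1+n n)))

    build-ext : ∀ n {rec rec′ : <-Rec (λ _ → Node) n} →
                (∀ {m} (m<n : m < n) → rec m<n ≡ rec′ m<n) → build n rec ≡ build n rec′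
    build-ext zero    eq = refl
    build-ext (suc n) eq =
      cong₂ (λ p q → child (position p) (value q)) (eq (s≤s (unpair₁-≤ n))) (eq (n<1+n n))

    abstract
      -- The node with index suc (pair i n) is a child of the node with index i,
      -- and its value exceeds those of all nodes of smaller index.
      nodeAt : ℕ → Node
      nodeAt = <-rec (λ _ → Node) build

      nodeAt-suc : ∀ n → nodeAt (suc n) ≡
                   child (position (nodeAt (proj₁ (unpair n)))) (value (nodeAt n))
      nodeAt-suc n = FixPoint.unfold-wfRec <-wellFounded (λ _ → Node) build build-ext {suc n}

    -- Values grow along the whole enumeration, not only among siblings; hence `φ` is one-to-one and
    -- images of infinite sets of nodes are unbounded.
    value-increasing : Increasing (value ∘ nodeAt)
    value-increasing n = subst (λ q → value (nodeAt n) < value q) (sym (nodeAt-suc n))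
      (child-value (position (nodeAt (proj₁ (unpair n)))) (value (nodeAt n)))

    -- Reversal puts the newest element at the head, so the code of `s ∷ʳ n` unpairs to the index of
    -- its parent `s`.
    treeNode : List ℕ → Node
    treeNode s = nodeAt (code (reverse s))

    treeNode-∷ʳ : ∀ s n →
      treeNode (s ∷ʳ n) ≡ child (position (treeNode s)) (value (nodeAt (pair (code (reverse s)) n)))
    treeNode-∷ʳ s n =
      trans (cong (nodeAt ∘ code) (reverse-++ s (n ∷ [])))
      (trans (nodeAt-suc (pair (code (reverse s)) n))
             (cong (λ i → child (position (nodeAt i)) (value (nodeAt (pair (code (reverse s)) n))))
                   (cong proj₁ (unpair-pair (code (reverse s)) n))))

    treeStep : ∀ s n →
      Step (position (treeNode s)) (splitting (position (treeNode s))) (treeNode (s ∷ʳ n))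
    treeStep s n = subst (Step p (splitting p)) (sym (treeNode-∷ʳ s n))
      (child-step p (value (nodeAt (pair (code (reverse s)) n))))
      where p = position (treeNode s)

    φ : FinSeq → ℕ
    φ t = value (treeNode (seq t))

    φ-injective : Injective _≡_ _≡_ φ
    φ-injective {mkFinSeq s _} {mkFinSeq t _} eq
      with reverse-injective {x = s} {y = t} (code-injective (increasing⇒injective value-increasing eq))
    ... | refl = refl

    module _ (σ : InfSeq) where

      along : ℕ → Node
      along n = treeNode (applyUpTo (at σ) n)

      along-step : ∀ n →
        Step (position (along n)) (splitting (position (along n))) (along (suc n))
      along-step n = subst (λ s → Step p (splitting p) (treeNode s))
        (applyUpTo-∷ʳ (at σ) n) (treeStep (applyUpTo (at σ) n) (at σ n))
        where p = position (along n)

      branch-limit : ℕ → ℕ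
      branch-limit = limit (Node.point ∘ along)

      -- The limit lies in every cone along `σ`, and each cone forces its value into `f`.
      image-branch⊆ : image φ (branch σ) ⊆ f branch-limit
      image-branch⊆ (_ , (n , refl) , refl) =
        value∈ (along n) (limit∈Cone (Step.deeper ∘ along-step) (λ n → Step.refine (along-step n)) n)

    image-successors⊆ : ∀ t → image φ (successors t) ⊆ splitting (position (treeNode (seq t)))
    image-successors⊆ (mkFinSeq s _) (_ , (n , _ , refl) , refl) = Step.value∈B (treeStep s n)

    -- An increasing enumeration gives each node a value at least its index, so unbounded codes
    -- yield unbounded values.
    infinite-image : ∀ {E} → (∀ m → ∃[ u ] (u ∈ E × m ≤ code (reverse (seq u)))) →
                     Infinite (image φ E)
    infinite-image unbounded = unbounded⇒infinite λ m → case unbounded m of λ where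
      (u , u∈E , m≤code) →
        φ u , ≤-trans m≤code (increasing⇒n≤ value-increasing _) , u , u∈E , refl

    infinite-image-branch : ∀ σ → Infinite (image φ (branch σ))
    infinite-image-branch σ = infinite-image λ m →
      σ ∣ m , (m , refl) ,
      subst (_≤ code (reverse (applyUpTo (at σ) m)))
        (trans (length-reverse (applyUpTo (at σ) m)) (length-applyUpTo (at σ) m))
        (length≤code (reverse (applyUpTo (at σ) m)))

    infinite-image-successors : ∀ t → Infinite (image φ (successors t))
    infinite-image-successors t@(mkFinSeq s _) = infinite-image λ m →
      -- The first term lets `n` extend `t`; the second brings the code up to `m`.
      let n   = suc (max 0 s) ⊔ m
          t<n = All.map (λ x≤max → ≤-trans (s≤s x≤max) (m≤m⊔n (suc (max 0 s)) m)) (xs≤max 0 s)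
      in extend t n t<n , (n , t<n , refl) ,
         subst (λ r → m ≤ code r) (sym (reverse-++ s (n ∷ [])))
           (≤-trans (m≤n⊔m (suc (max 0 s)) m) (m≤n⇒m≤1+n (n≤pair (code (reverse s)) n)))

theorem4 : ExcludedMiddle 1ℓ →
    (𝒜 ℬ : Family ℕ) →
    𝒜 ⊆ Infinite → ℬ ⊆ Infinite →
    Hereditary 𝒜 → Hereditary ℬ → Orthogonal 𝒜 ℬ →
    Analytic 𝒜 → ¬ CountablyGeneratedIn 𝒜 (ℬ ^⊥) →
    Σ[ φ ∈ (FinSeq → ℕ) ]
    (Injective _≡_ _≡_ φ ×
    (∀ (σ : InfSeq) → branch σ ∈ φ ⁻¹[ 𝒜 ]) ×
    (∀ (t : FinSeq) → successors t ∈ φ ⁻¹[ ℬ ]))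
-- An empty `𝒜` is generated by no sets at all, against the hypothesis.
theorem4 _ 𝒜 ℬ _ _ _ _ _ (inj₁ 𝒜-empty) ¬gen = contradiction
  ((λ _ → ⊥) , (λ _ _ → ⊥) , (λ ()) , λ {A} A∈𝒜 → contradiction A∈𝒜 (𝒜-empty A)) ¬gen
theorem4 em 𝒜 ℬ 𝒜-infinite _ 𝒜-hereditary ℬ-hereditary _ (inj₂ (f , f-continuous , 𝒜⊆f , f⊆𝒜)) ¬gen =
  φ , φ-injective ,
  (λ σ → image∈⇒∈⁻¹ {𝒜 = 𝒜} φ-injective
    (𝒜-hereditary (f∈𝒜 (branch-limit σ)) (image-branch⊆ σ) (infinite-image-branch σ))) ,
  (λ t → image∈⇒∈⁻¹ {𝒜 = ℬ} φ-injective
    (ℬ-hereditary (splitting∈ℬ (Node.position (treeNode (seq t)))) (image-successors⊆ t) (infinite-image-successors t)))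
  where
  f∈𝒜 : ∀ x → f x ∈ 𝒜
  f∈𝒜 x = f⊆𝒜 (x , id , id)

  open Construction em ℬ f (𝒜-infinite ∘ f∈𝒜) f-continuous

  root : Position
  root = record
    { point = λ _ → 0
    -- At depth 0 the cone is all of Baire space, so generating it would generate `𝒜`.
    ; depth = 0
    ; large = λ (I , D , D∈ , covers) → ¬gen (I , D , D∈ , λ A∈𝒜 →
        let x , A⊆fx , _ = 𝒜⊆f A∈𝒜
            n , n∈I , fin = covers {x} (λ ())
        in n , n∈I , finite-⊆ (λ (j∈A , j∉D) → A⊆fx j∈A , j∉D) fin)
    }

  open Tree root
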